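{- Let $\mathcal{C}$ be a finitely complete category with coequalizers and finite coproducts in which regular epimorphisms are closed under composition, let $n$ be a natural number, and let $H\colon\mathcal{C}^n\to\mathcal{C}^n$ be a monomorphism-preserving functor. If $\mathcal{C}$ is extensive, then every $H$-coalgebra $\xi\colon X\to HX$ and its induced $H\Delta\coprod$-coalgebra $$X\xrightarrow{\xi}HX\xrightarrow{H\eta_X}H\Delta\textstyle\coprod X$$ have the same quotients (i.e. a regular epimorphism $q\colon X\twoheadrightarrow Y$ in $\mathcal{C}^n$ carries an $H$-coalgebra morphism with domain $(X,\xi)$ if and only if it carries an $H\Delta\coprod$-coalgebra morphism with domain $(X,H\eta_X\cdot\xi)$) and, hence, the same simple quotient.
   Context: $\Delta\colon\mathcal{C}\to\mathcal{C}^n$, $\Delta(X)=(X,\dots,X)$, is the diagonal functor, with left adjoint $\coprod\colon\mathcal{C}^n\to\mathcal{C}$, $\coprod(X_1,\dots,X_n)=X_1+\dots+X_n$; the unit $\eta_X\colon X\to\Delta\coprod X$ consists of the coproduct injections. For an endofunctor $F$, an $F$-coalgebra is a morphism $\xi\colon X\to FX$, and a coalgebra morphism $(X,\xi)\to(Y,\zeta)$ is a morphism $h$ with $\zeta\cdot h=Fh\cdot\xi$. A quotient of a coalgebra is a coalgebra morphism with that domain carried by a regular epimorphism of the base category; a coalgebra is simple if each of its quotients is an isomorphism; a simple quotient is a quotient with simple codomain (unique up to isomorphism if it exists). A category $\mathcal{C}$ with finite coproducts is extensive if for all objects $Y_1,Y_2$ the canonical functor $\mathcal{C}/Y_1\times\mathcal{C}/Y_2\to\mathcal{C}/(Y_1+Y_2)$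 is an equivalence of categories. -}

module Defs where

open import Level using (Level; _⊔_; 0ℓ) renaming (suc to lsuc)
open import Data.Nat using (ℕ)
open import Data.Fin using (Fin; zero; suc)
open import Data.Product using (Σ; Σ-syntax; _×_; _,_; proj₁; proj₂)
open import Data.Vec.Functional using (_∷_; [])
open import Function.Bundles using (Inverse; _↔_)
open import Relation.Binary.Bundles using (Setoid)
open import Relation.Binary.Structures using (IsEquivalence)
open import Relation.Binary.PropositionalEquality using (setoid)
import Relation.Binary.Reasoning.Setoid as SetoidReasoning

private
  variable
    o ℓ e o′ ℓ′ e′ o″ ℓ″ e″ : Level

-- Parallel morphisms are compared by an equivalence relation; objects are
-- never compared.
record Category (o ℓ e : Level) : Set (lsuc (o ⊔ ℓ ⊔ e)) where
  infix  4 _⇒_ _≈_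
  infixr 9 _∘_
  field
    Obj       : Set o
    _⇒_       : Obj → Obj → Set ℓ
    _≈_       : ∀ {A B} → A ⇒ B → A ⇒ B → Set e
    id        : ∀ {A} → A ⇒ A
    _∘_       : ∀ {A B C} → B ⇒ C → A ⇒ B → A ⇒ C
    equiv     : ∀ {A B} → IsEquivalence (_≈_ {A} {B})
    ∘-resp-≈  : ∀ {A B C} {f f′ : B ⇒ C} {g g′ : A ⇒ B} →
                f ≈ f′ → g ≈ g′ → f ∘ g ≈ f′ ∘ g′
    assoc     : ∀ {A B C D} {f : A ⇒ B} {g : B ⇒ C} {h : C ⇒ D} →
                (h ∘ g) ∘ f ≈ h ∘ (g ∘ f)
    identityˡ : ∀ {A B} {f : A ⇒ B} → id ∘ f ≈ f
    identityʳ : ∀ {A B} {f : A ⇒ B} → f ∘ id ≈ f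

  hom-setoid : Obj → Obj → Setoid ℓ e
  hom-setoid A B = record
    { Carrier = A ⇒ B ; _≈_ = _≈_ ; isEquivalence = equiv }

  module Equiv {A B : Obj} = IsEquivalence (equiv {A} {B})
  module HomReasoning {A B : Obj} = SetoidReasoning (hom-setoid A B)

record Functor (C : Category o ℓ e) (D : Category o′ ℓ′ e′)
       : Set (o ⊔ ℓ ⊔ e ⊔ o′ ⊔ ℓ′ ⊔ e′) where
  private
    module C = Category C
    module D = Category D
  field
    F₀           : C.Obj → D.Obj
    F₁           : ∀ {A B} → A C.⇒ B → F₀ A D.⇒ F₀ B
    identity     : ∀ {A} → F₁ (C.id {A}) D.≈ D.id
    homomorphism : ∀ {A B E} {f : A C.⇒ B} {g : B C.⇒ E} →
                   F₁ (g C.∘ f) D.≈ F₁ g D.∘ F₁ f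
    F-resp-≈     : ∀ {A B} {f g : A C.⇒ B} → f C.≈ g → F₁ f D.≈ F₁ g

idF : {C : Category o ℓ e} → Functor C C
idF {C = C} = record
  { F₀           = λ A → A
  ; F₁           = λ f → f
  ; identity     = Equiv.refl
  ; homomorphism = Equiv.refl
  ; F-resp-≈     = λ p → p
  }
  where open Category C

infixr 9 _∘F_

_∘F_ : {C : Category o ℓ e} {D : Category o′ ℓ′ e′} {E : Category o″ ℓ″ e″} →
       Functor D E → Functor C D → Functor C E
_∘F_ {E = E} G F = record
  { F₀           = λ A → G.F₀ (F.F₀ A)
  ; F₁           = λ f → G.F₁ (F.F₁ f)
  ; identity     = Equiv.trans (G.F-resp-≈ F.identity) G.identity
  ; homomorphism = Equiv.trans (G.F-resp-≈ F.homomorphism) G.homomorphism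
  ; F-resp-≈     = λ p → G.F-resp-≈ (F.F-resp-≈ p)
  }
  where
  open Category E
  module F = Functor F
  module G = Functor G

record NaturalTransformation {C : Category o ℓ e} {D : Category o′ ℓ′ e′}
       (F G : Functor C D) : Set (o ⊔ ℓ ⊔ e ⊔ o′ ⊔ ℓ′ ⊔ e′) where
  private
    module C = Category C
    module D = Category D
    module F = Functor F
    module G = Functor G
  field
    component : ∀ A → F.F₀ A D.⇒ G.F₀ A
    natural   : ∀ {A B} (f : A C.⇒ B) →
                component B D.∘ F.F₁ f D.≈ G.F₁ f D.∘ component A

module _ (C : Category o ℓ e) where
  open Category C

  IsMono : ∀ {A B} → A ⇒ B → Set (o ⊔ ℓ ⊔ e)
  IsMono {A} m = ∀ {Z} (f g : Z ⇒ A) → m ∘ f ≈ m ∘ g → f ≈ g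

  record IsIso {A B} (f : A ⇒ B) : Set (ℓ ⊔ e) where
    field
      inv  : B ⇒ A
      isoˡ : inv ∘ f ≈ id
      isoʳ : f ∘ inv ≈ id

  record IsCoequalizer {A B Q} (f g : A ⇒ B) (q : B ⇒ Q) : Set (o ⊔ ℓ ⊔ e) where
    field
      coequalizes : q ∘ f ≈ q ∘ g
      factor      : ∀ {Z} (h : B ⇒ Z) → h ∘ f ≈ h ∘ g → Q ⇒ Z
      factors     : ∀ {Z} (h : B ⇒ Z) (eq : h ∘ f ≈ h ∘ g) → factor h eq ∘ q ≈ h
      unique      : ∀ {Z} (h : B ⇒ Z) (eq : h ∘ f ≈ h ∘ g) (k : Q ⇒ Z) →
                    k ∘ q ≈ h → k ≈ factor h eq

  HasCoequalizers : Set (o ⊔ ℓ ⊔ e)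
  HasCoequalizers = ∀ {A B} (f g : A ⇒ B) →
    Σ[ Q ∈ Obj ] Σ[ q ∈ (B ⇒ Q) ] IsCoequalizer f g q

  IsRegularEpi : ∀ {B Q} → B ⇒ Q → Set (o ⊔ ℓ ⊔ e)
  IsRegularEpi {B} q =
    Σ[ A ∈ Obj ] Σ[ f ∈ (A ⇒ B) ] Σ[ g ∈ (A ⇒ B) ] IsCoequalizer f g q

  RegularEpisClosedUnderComposition : Set (o ⊔ ℓ ⊔ e)
  RegularEpisClosedUnderComposition =
    ∀ {A B D} (p : B ⇒ D) (q : A ⇒ B) →
    IsRegularEpi p → IsRegularEpi q → IsRegularEpi (p ∘ q)

PreservesMonos : {C : Category o ℓ e} {D : Category o′ ℓ′ e′} → Functor C D →
                 Set (o ⊔ ℓ ⊔ e ⊔ o′ ⊔ ℓ′ ⊔ e′)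
PreservesMonos {C = C} {D = D} F =
  ∀ {A B} (m : Category._⇒_ C A B) → IsMono C m → IsMono D (Functor.F₁ F m)

record IsFiniteCategory (J : Category 0ℓ 0ℓ 0ℓ) : Set where
  open Category J
  field
    #Obj    : ℕ
    objEnum : Fin #Obj ↔ Obj
    #Hom    : Obj → Obj → ℕ
    homEnum : ∀ A B → Inverse (setoid (Fin (#Hom A B))) (hom-setoid A B)

record Cone {J : Category o′ ℓ′ e′} {C : Category o ℓ e} (D : Functor J C)
       (N : Category.Obj C) : Set (o′ ⊔ ℓ′ ⊔ ℓ ⊔ e) where
  private
    module J = Category J
    module C = Category C
    module D = Functor D
  field
    leg      : ∀ j → N C.⇒ D.F₀ j
    commutes : ∀ {i j} (u : i J.⇒ j) → D.F₁ u C.∘ leg i C.≈ leg j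

record Limit {J : Category o′ ℓ′ e′} {C : Category o ℓ e} (D : Functor J C)
       : Set (o ⊔ ℓ ⊔ e ⊔ o′ ⊔ ℓ′) where
  open Category C
  open Cone
  field
    apex     : Obj
    cone     : Cone D apex
    mediate  : ∀ {N} → Cone D N → N ⇒ apex
    mediates : ∀ {N} (K : Cone D N) j → leg cone j ∘ mediate K ≈ leg K j
    unique   : ∀ {N} (K : Cone D N) (k : N ⇒ apex) →
               (∀ j → leg cone j ∘ k ≈ leg K j) → k ≈ mediate K

FinitelyComplete : Category o ℓ e → Set (lsuc 0ℓ ⊔ o ⊔ ℓ ⊔ e)
FinitelyComplete C =
  ∀ (J : Category 0ℓ 0ℓ 0ℓ) → IsFiniteCategory J → (D : Functor J C) → Limit D

record Coproduct (C : Category o ℓ e) {n : ℕ} (X : Fin n → Category.Obj C)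
       : Set (o ⊔ ℓ ⊔ e) where
  open Category C
  field
    obj     : Obj
    inj     : ∀ i → X i ⇒ obj
    [_]     : ∀ {Z} → (∀ i → X i ⇒ Z) → obj ⇒ Z
    commute : ∀ {Z} (f : ∀ i → X i ⇒ Z) i → [ f ] ∘ inj i ≈ f i
    unique  : ∀ {Z} (f : ∀ i → X i ⇒ Z) (k : obj ⇒ Z) →
              (∀ i → k ∘ inj i ≈ f i) → k ≈ [ f ]

-- The same chosen coproducts serve for the n-ary functor ∐, for the binary sums
-- in extensivity (n = 2) and for the initial object (n = 0).
HasFiniteCoproducts : Category o ℓ e → Set (o ⊔ ℓ ⊔ e)
HasFiniteCoproducts C =
  ∀ {n} (X : Fin n → Category.Obj C) → Coproduct C X

Power : Category o ℓ e → ℕ → Category o ℓ e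
Power C n = record
  { Obj       = Fin n → Obj
  ; _⇒_       = λ X Y → ∀ i → X i ⇒ Y i
  ; _≈_       = λ f g → ∀ i → f i ≈ g i
  ; id        = λ i → id
  ; _∘_       = λ g f i → g i ∘ f i
  ; equiv     = record
      { refl  = λ i → Equiv.refl
      ; sym   = λ p i → Equiv.sym (p i)
      ; trans = λ p q i → Equiv.trans (p i) (q i)
      }
  ; ∘-resp-≈  = λ p q i → ∘-resp-≈ (p i) (q i)
  ; assoc     = λ i → assoc
  ; identityˡ = λ i → identityˡ
  ; identityʳ = λ i → identityʳ
  }
  where open Category C

Δ : (C : Category o ℓ e) (n : ℕ) → Functor C (Power C n)
Δ C n = record
  { F₀           = λ X i → X
  ; F₁           = λ f i → f
  ; identity     = λ i → Equiv.refl
  ; homomorphism = λ i → Equiv.refl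
  ; F-resp-≈     = λ p i → p
  }
  where open Category C

module _ {C : Category o ℓ e} (coprod : HasFiniteCoproducts C) where
  open Category C
  private
    module ∐ {n} (X : Fin n → Obj) = Coproduct (coprod X)

  ∐₁ : ∀ {n} {X Y : Fin n → Obj} → (∀ i → X i ⇒ Y i) → ∐.obj X ⇒ ∐.obj Y
  ∐₁ {X = X} {Y} f = ∐.[ X ] (λ i → ∐.inj Y i ∘ f i)

  ∐₁-inj : ∀ {n} {X Y : Fin n → Obj} (f : ∀ i → X i ⇒ Y i) i →
           ∐₁ {X = X} {Y} f ∘ ∐.inj X i ≈ ∐.inj Y i ∘ f i
  ∐₁-inj {X = X} f = ∐.commute X _

  ∐-jointly-epic : ∀ {n} (X : Fin n → Obj) {Z} (f g : ∐.obj X ⇒ Z) →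
                   (∀ i → f ∘ ∐.inj X i ≈ g ∘ ∐.inj X i) → f ≈ g
  ∐-jointly-epic X f g p =
    Equiv.trans (∐.unique X _ f p)
                (Equiv.sym (∐.unique X _ g (λ i → Equiv.refl)))

  ∐₁-∘ : ∀ {n} {X Y Z : Fin n → Obj}
         (g : ∀ i → Y i ⇒ Z i) (f : ∀ i → X i ⇒ Y i) →
         ∐₁ {X = X} {Z} (λ i → g i ∘ f i) ≈ ∐₁ {X = Y} {Z} g ∘ ∐₁ {X = X} {Y} f
  ∐₁-∘ {X = X} {Y} {Z} g f = ∐-jointly-epic X _ _ λ i → begin
    ∐₁ {X = X} {Z} (λ i → g i ∘ f i) ∘ ∐.inj X i  ≈⟨ ∐₁-inj {X = X} {Z} _ i ⟩
    ∐.inj Z i ∘ (g i ∘ f i)                        ≈⟨ assoc ⟨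
    (∐.inj Z i ∘ g i) ∘ f i                        ≈⟨ ∘-resp-≈ (∐₁-inj {X = Y} {Z} g i) Equiv.refl ⟨
    (∐₁ {X = Y} {Z} g ∘ ∐.inj Y i) ∘ f i           ≈⟨ assoc ⟩
    ∐₁ {X = Y} {Z} g ∘ (∐.inj Y i ∘ f i)           ≈⟨ ∘-resp-≈ Equiv.refl (∐₁-inj {X = X} {Y} f i) ⟨
    ∐₁ {X = Y} {Z} g ∘ (∐₁ {X = X} {Y} f ∘ ∐.inj X i)  ≈⟨ assoc ⟨
    (∐₁ {X = Y} {Z} g ∘ ∐₁ {X = X} {Y} f) ∘ ∐.inj X i  ∎
    where open HomReasoning

  ∐₁-id : ∀ {n} (X : Fin n → Obj) → ∐₁ {X = X} {X} (λ i → id) ≈ id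
  ∐₁-id X = ∐-jointly-epic X _ _ λ i →
    Equiv.trans (∐₁-inj {X = X} {X} _ i)
                (Equiv.trans identityʳ (Equiv.sym identityˡ))

  ∐₁-resp-≈ : ∀ {n} {X Y : Fin n → Obj} {f g : ∀ i → X i ⇒ Y i} →
              (∀ i → f i ≈ g i) → ∐₁ {X = X} {Y} f ≈ ∐₁ {X = X} {Y} g
  ∐₁-resp-≈ {X = X} p = ∐.unique X _ _ λ i →
    Equiv.trans (∐.commute X _ i) (∘-resp-≈ Equiv.refl (p i))

  ∐ : (n : ℕ) → Functor (Power C n) C
  ∐ n = record
    { F₀           = λ X → ∐.obj X
    ; F₁           = λ {X} {Y} f → ∐₁ {X = X} {Y} f
    ; identity     = λ {X} → ∐₁-id X
    ; homomorphism = λ {X} {Y} {Z} {f} {g} → ∐₁-∘ {X = X} {Y} {Z} g f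
    ; F-resp-≈     = λ {X} {Y} p → ∐₁-resp-≈ {X = X} {Y} p
    }

  η : (n : ℕ) → NaturalTransformation idF (Δ C n ∘F ∐ n)
  η n = record
    { component = λ X i → ∐.inj X i
    ; natural   = λ {X} {Y} f i → Equiv.sym (∐₁-inj {X = X} {Y} f i)
    }

  infixr 6 _⊕_ _⊕₁_

  _⊕_ : Obj → Obj → Obj
  A ⊕ B = ∐.obj (A ∷ B ∷ [])

  pair : ∀ {A A′ B B′} → A ⇒ A′ → B ⇒ B′ →
         ∀ i → (A ∷ B ∷ []) i ⇒ (A′ ∷ B′ ∷ []) i
  pair f g zero       = f
  pair f g (suc zero) = g

  _⊕₁_ : ∀ {A A′ B B′} → A ⇒ A′ → B ⇒ B′ → A ⊕ B ⇒ A′ ⊕ B′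
  _⊕₁_ {A} {A′} {B} {B′} f g = ∐₁ {X = A ∷ B ∷ []} {A′ ∷ B′ ∷ []} (pair f g)

  ⊕₁-id : ∀ {A B} → id {A} ⊕₁ id {B} ≈ id
  ⊕₁-id {A} {B} = Equiv.trans
    (∐₁-resp-≈ {X = A ∷ B ∷ []} {A ∷ B ∷ []}
      λ { zero → Equiv.refl ; (suc zero) → Equiv.refl })
    (∐₁-id (A ∷ B ∷ []))

  ⊕₁-∘ : ∀ {A A′ A″ B B′ B″} {f : A ⇒ A′} {f′ : A′ ⇒ A″} {g : B ⇒ B′} {g′ : B′ ⇒ B″} →
         (f′ ∘ f) ⊕₁ (g′ ∘ g) ≈ (f′ ⊕₁ g′) ∘ (f ⊕₁ g)
  ⊕₁-∘ {A} {A′} {A″} {B} {B′} {B″} {f} {f′} {g} {g′} = Equiv.trans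
    (∐₁-resp-≈ {X = A ∷ B ∷ []} {A″ ∷ B″ ∷ []}
      λ { zero → Equiv.refl ; (suc zero) → Equiv.refl })
    (∐₁-∘ {X = A ∷ B ∷ []} {A′ ∷ B′ ∷ []} {A″ ∷ B″ ∷ []} (pair f′ g′) (pair f g))

  ⊕₁-resp-≈ : ∀ {A A′ B B′} {f f′ : A ⇒ A′} {g g′ : B ⇒ B′} →
              f ≈ f′ → g ≈ g′ → f ⊕₁ g ≈ f′ ⊕₁ g′
  ⊕₁-resp-≈ {A} {A′} {B} {B′} p q =
    ∐₁-resp-≈ {X = A ∷ B ∷ []} {A′ ∷ B′ ∷ []}
      λ { zero → p ; (suc zero) → q }

infixr 2 _×ᶜ_

_×ᶜ_ : Category o ℓ e → Category o′ ℓ′ e′ → Category (o ⊔ o′) (ℓ ⊔ ℓ′) (e ⊔ e′)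
C ×ᶜ D = record
  { Obj       = C.Obj × D.Obj
  ; _⇒_       = λ (A , A′) (B , B′) → (A C.⇒ B) × (A′ D.⇒ B′)
  ; _≈_       = λ (f , f′) (g , g′) → (f C.≈ g) × (f′ D.≈ g′)
  ; id        = C.id , D.id
  ; _∘_       = λ (g , g′) (f , f′) → (g C.∘ f) , (g′ D.∘ f′)
  ; equiv     = record
      { refl  = C.Equiv.refl , D.Equiv.refl
      ; sym   = λ (p , p′) → C.Equiv.sym p , D.Equiv.sym p′
      ; trans = λ (p , p′) (q , q′) → C.Equiv.trans p q , D.Equiv.trans p′ q′
      }
  ; ∘-resp-≈  = λ (p , p′) (q , q′) → C.∘-resp-≈ p q , D.∘-resp-≈ p′ q′
  ; assoc     = C.assoc , D.assoc
  ; identityˡ = C.identityˡ , D.identityˡ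
  ; identityʳ = C.identityʳ , D.identityʳ
  }
  where
  module C = Category C
  module D = Category D

module _ (C : Category o ℓ e) (Y : Category.Obj C) where
  open Category C

  record SliceObj : Set (o ⊔ ℓ) where
    constructor sliceObj
    field
      {dom} : Obj
      arr   : dom ⇒ Y
  open SliceObj

  record SliceHom (A B : SliceObj) : Set (ℓ ⊔ e) where
    constructor sliceHom
    field
      mor      : dom A ⇒ dom B
      triangle : arr B ∘ mor ≈ arr A
  open SliceHom

  Slice : Category (o ⊔ ℓ) (ℓ ⊔ e) e
  Slice = record
    { Obj       = SliceObj
    ; _⇒_       = SliceHom
    ; _≈_       = λ f g → mor f ≈ mor g
    ; id        = sliceHom id identityʳ
    ; _∘_       = λ g f → sliceHom (mor g ∘ mor f)
        (Equiv.trans (Equiv.sym assoc)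
          (Equiv.trans (∘-resp-≈ (triangle g) Equiv.refl) (triangle f)))
    ; equiv     = record
        { refl = Equiv.refl ; sym = Equiv.sym ; trans = Equiv.trans }
    ; ∘-resp-≈  = ∘-resp-≈
    ; assoc     = assoc
    ; identityˡ = identityˡ
    ; identityʳ = identityʳ
    }

record IsCategoryEquivalence {C : Category o ℓ e} {D : Category o′ ℓ′ e′}
       (F : Functor C D) : Set (o ⊔ ℓ ⊔ e ⊔ o′ ⊔ ℓ′ ⊔ e′) where
  open NaturalTransformation
  field
    G          : Functor D C
    unit       : NaturalTransformation idF (G ∘F F)
    unit-iso   : ∀ A → IsIso C (component unit A)
    counit     : NaturalTransformation (F ∘F G) idF
    counit-iso : ∀ B → IsIso D (component counit B)

module _ {C : Category o ℓ e} (coprod : HasFiniteCoproducts C) where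
  open Category C
  open SliceObj
  open SliceHom

  canonical : (Y₁ Y₂ : Obj) →
              Functor (Slice C Y₁ ×ᶜ Slice C Y₂) (Slice C (_⊕_ coprod Y₁ Y₂))
  canonical Y₁ Y₂ = record
    { F₀           = λ (A , B) → sliceObj (_⊕₁_ coprod (arr A) (arr B))
    ; F₁           = λ (f , g) → sliceHom (_⊕₁_ coprod (mor f) (mor g))
        (Equiv.trans (Equiv.sym (⊕₁-∘ coprod))
          (⊕₁-resp-≈ coprod (triangle f) (triangle g)))
    ; identity     = ⊕₁-id coprod
    ; homomorphism = ⊕₁-∘ coprod
    ; F-resp-≈     = λ (p , q) → ⊕₁-resp-≈ coprod p q
    }

  Extensive : Set (o ⊔ ℓ ⊔ e)
  Extensive = ∀ Y₁ Y₂ → IsCategoryEquivalence (canonical Y₁ Y₂)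

module _ {C : Category o ℓ e} (F : Functor C C) where
  open Category C
  open Functor F

  record Coalgebra : Set (o ⊔ ℓ) where
    constructor coalgebra
    field
      {carrier} : Obj
      structure : carrier ⇒ F₀ carrier
  open Coalgebra

  IsCoalgebraMorphism : ∀ {X Y} → X ⇒ F₀ X → Y ⇒ F₀ Y → X ⇒ Y → Set e
  IsCoalgebraMorphism ξ ζ h = ζ ∘ h ≈ F₁ h ∘ ξ

  record CoalgebraHom (A B : Coalgebra) : Set (ℓ ⊔ e) where
    constructor coalgebraHom
    field
      hom        : carrier A ⇒ carrier B
      isMorphism : IsCoalgebraMorphism (structure A) (structure B) hom
  open CoalgebraHom

  Coalg : Category (o ⊔ ℓ) (ℓ ⊔ e) e
  Coalg = record
    { Obj       = Coalgebra
    ; _⇒_       = CoalgebraHom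
    ; _≈_       = λ f g → hom f ≈ hom g
    ; id        = coalgebraHom id
        (Equiv.trans identityʳ
          (Equiv.sym (Equiv.trans (∘-resp-≈ identity Equiv.refl) identityˡ)))
    ; _∘_       = λ {A} {B} {D} g f → coalgebraHom (hom g ∘ hom f) (begin
        structure D ∘ (hom g ∘ hom f)            ≈⟨ assoc ⟨
        (structure D ∘ hom g) ∘ hom f            ≈⟨ ∘-resp-≈ (isMorphism g) Equiv.refl ⟩
        (F₁ (hom g) ∘ structure B) ∘ hom f       ≈⟨ assoc ⟩
        F₁ (hom g) ∘ (structure B ∘ hom f)       ≈⟨ ∘-resp-≈ Equiv.refl (isMorphism f) ⟩
        F₁ (hom g) ∘ (F₁ (hom f) ∘ structure A)  ≈⟨ assoc ⟨
        (F₁ (hom g) ∘ F₁ (hom f)) ∘ structure A  ≈⟨ ∘-resp-≈ homomorphism Equiv.refl ⟨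
        F₁ (hom g ∘ hom f) ∘ structure A         ∎)
    ; equiv     = record
        { refl = Equiv.refl ; sym = Equiv.sym ; trans = Equiv.trans }
    ; ∘-resp-≈  = ∘-resp-≈
    ; assoc     = assoc
    ; identityˡ = identityˡ
    ; identityʳ = identityʳ
    }
    where open HomReasoning

  IsQuotient : ∀ {A B} → CoalgebraHom A B → Set (o ⊔ ℓ ⊔ e)
  IsQuotient h = IsRegularEpi C (hom h)

  IsSimple : Coalgebra → Set (o ⊔ ℓ ⊔ e)
  IsSimple A = ∀ {B} (h : CoalgebraHom A B) → IsQuotient h → IsIso Coalg h

  -- The structure on the codomain is existentially quantified: q "carries" a
  -- coalgebra morphism with domain (X , ξ).
  CarriesMorphism : ∀ {X Y} → X ⇒ F₀ X → X ⇒ Y → Set (ℓ ⊔ e)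
  CarriesMorphism {Y = Y} ξ q = Σ[ ζ ∈ (Y ⇒ F₀ Y) ] IsCoalgebraMorphism ξ ζ q

  CarriesSimpleQuotient : ∀ {X Y} → X ⇒ F₀ X → X ⇒ Y → Set (o ⊔ ℓ ⊔ e)
  CarriesSimpleQuotient {X} {Y} ξ q =
    Σ[ ζ ∈ (Y ⇒ F₀ Y) ] Σ[ m ∈ IsCoalgebraMorphism ξ ζ q ]
      IsQuotient {coalgebra ξ} {coalgebra ζ} (coalgebraHom q m)
      × IsSimple (coalgebra ζ)

module _ {C : Category o ℓ e} (coprod : HasFiniteCoproducts C) {n : ℕ}
         (H : Functor (Power C n) (Power C n)) where
  open Category (Power C n)
  open Functor H

  HΔ∐ : Functor (Power C n) (Power C n)
  HΔ∐ = H ∘F Δ C n ∘F ∐ coprod n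

  induced : ∀ X → X ⇒ F₀ X → X ⇒ Functor.F₀ HΔ∐ X
  induced X ξ = _∘_ {X} {F₀ X} {Functor.F₀ HΔ∐ X}
    (F₁ (NaturalTransformation.component (η coprod n) X)) ξ

{-# OPTIONS --safe #-}
-- In an extensive category the coproduct injections are monic, so η is monic
-- and H η is a natural transformation H → H Δ ∐ with monic components.  For any
-- τ : F → G with monic components, a regular epimorphism q that carries a
-- G-coalgebra morphism out of (X, τ ξ) makes τ ∘ (F q ∘ ξ) factor through q;
-- cancelling τ, the morphism F q ∘ ξ respects the pair coequalized by q and
-- hence itself factors through q.
module Submission where

open import Defs
open import Level using (Level)
open import Data.Nat using (ℕ)
open import Data.Fin using (Fin; zero; suc; _≟_)
open import Data.Product using (Σ-syntax; _×_; _,_; proj₁; proj₂)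
open import Data.Vec.Functional using (_∷_; [])
open import Function.Bundles using (_⇔_; mk⇔)
open import Relation.Nullary using (Dec; yes; no)
open import Relation.Binary.PropositionalEquality using (_≡_; refl; ≡-≟-identity)

private
  variable
    o ℓ e o′ ℓ′ e′ : Level

-- Cancelling epimorphisms, monomorphisms and isomorphisms.

module _ (C : Category o ℓ e) where
  open Category C

  coequalizer⇒epic : ∀ {A B Q} {f g : A ⇒ B} {q : B ⇒ Q} →
                     IsCoequalizer C f g q →
                     ∀ {Z} (h k : Q ⇒ Z) → h ∘ q ≈ k ∘ q → h ≈ k
  coequalizer⇒epic {f = f} {g} {q} coeq h k hq≈kq =
    Equiv.trans (unique (k ∘ q) kqf≈kqg h hq≈kq)
                (Equiv.sym (unique (k ∘ q) kqf≈kqg k Equiv.refl))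
    where
    open IsCoequalizer coeq
    kqf≈kqg : (k ∘ q) ∘ f ≈ (k ∘ q) ∘ g
    kqf≈kqg = Equiv.trans assoc
      (Equiv.trans (∘-resp-≈ Equiv.refl coequalizes) (Equiv.sym assoc))

  -- The mono `k` is kept apart from `p ∘ m` because in both uses, with `k` an identity or `inl`,
  -- the composite equals it only up to `≈`.
  ∘-monicˡ : ∀ {A B D} {p : B ⇒ D} {m : A ⇒ B} {k : A ⇒ D} →
             p ∘ m ≈ k → IsMono C k → IsMono C m
  ∘-monicˡ {p = p} {m} {k} pm≈k k-mono f g mf≈mg = k-mono f g (begin
    k ∘ f        ≈⟨ ∘-resp-≈ pm≈k Equiv.refl ⟨
    (p ∘ m) ∘ f  ≈⟨ assoc ⟩
    p ∘ (m ∘ f)  ≈⟨ ∘-resp-≈ Equiv.refl mf≈mg ⟩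
    p ∘ (m ∘ g)  ≈⟨ assoc ⟨
    (p ∘ m) ∘ g  ≈⟨ ∘-resp-≈ pm≈k Equiv.refl ⟩
    k ∘ g        ∎)
    where open HomReasoning

  iso-cancelʳ : ∀ {A B Z} {i : A ⇒ B} → IsIso C i →
                (f g : B ⇒ Z) → f ∘ i ≈ g ∘ i → f ≈ g
  iso-cancelʳ {i = i} i-iso f g fi≈gi = begin
    f              ≈⟨ identityʳ ⟨
    f ∘ id         ≈⟨ ∘-resp-≈ Equiv.refl isoʳ ⟨
    f ∘ (i ∘ inv)  ≈⟨ assoc ⟨
    (f ∘ i) ∘ inv  ≈⟨ ∘-resp-≈ fi≈gi Equiv.refl ⟩
    (g ∘ i) ∘ inv  ≈⟨ assoc ⟩
    g ∘ (i ∘ inv)  ≈⟨ ∘-resp-≈ Equiv.refl isoʳ ⟩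
    g ∘ id         ≈⟨ identityʳ ⟩
    g              ∎
    where
    open IsIso i-iso
    open HomReasoning

-- Fullness of an equivalence of categories.

module _ {C : Category o ℓ e} {D : Category o′ ℓ′ e′} {F : Functor C D}
         (equivalence : IsCategoryEquivalence F) where
  private
    module C = Category C
    module D = Category D
    module F = Functor F
  open IsCategoryEquivalence equivalence
  private
    module G = Functor G
    module unit = NaturalTransformation unit
    module counit = NaturalTransformation counit

  -- By naturality of the counit, `h` and `k` agree after precomposition with its component at `A`,
  -- which is invertible.
  inverse-faithful : ∀ {A B} (h k : A D.⇒ B) → G.F₁ h C.≈ G.F₁ k → h D.≈ k
  inverse-faithful {A} {B} h k Gh≈Gk = iso-cancelʳ D (counit-iso A) h k (begin
    h D.∘ counit.component A                    ≈⟨ counit.natural h ⟨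
    counit.component B D.∘ F.F₁ (G.F₁ h)        ≈⟨ D.∘-resp-≈ D.Equiv.refl (F.F-resp-≈ Gh≈Gk) ⟩
    counit.component B D.∘ F.F₁ (G.F₁ k)        ≈⟨ counit.natural k ⟩
    k D.∘ counit.component A                    ∎)
    where open D.HomReasoning

  -- The preimage is `G h` conjugated by the unit. No triangle identity is at hand to compare `F k`
  -- with `h` directly, so they are compared under the faithful `G`, where naturality of the unit
  -- suffices.
  equivalence-full : ∀ {A B} (h : F.F₀ A D.⇒ F.F₀ B) →
                     Σ[ k ∈ (A C.⇒ B) ] F.F₁ k D.≈ h
  equivalence-full {A} {B} h =
    k , inverse-faithful (F.F₁ k) h
          (iso-cancelʳ C (unit-iso A) (G.F₁ (F.F₁ k)) (G.F₁ h) (begin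
    G.F₁ (F.F₁ k) C.∘ unit.component A   ≈⟨ unit.natural k ⟨
    unit.component B C.∘ k               ≈⟨ C.assoc ⟨
    (unit.component B C.∘ inv) C.∘ (G.F₁ h C.∘ unit.component A)
                                         ≈⟨ C.∘-resp-≈ isoʳ C.Equiv.refl ⟩
    C.id C.∘ (G.F₁ h C.∘ unit.component A)
                                         ≈⟨ C.identityˡ ⟩
    G.F₁ h C.∘ unit.component A          ∎))
    where
    open IsIso (unit-iso B)
    open C.HomReasoning
    k : A C.⇒ B
    k = inv C.∘ (G.F₁ h C.∘ unit.component A)

-- Monic coproduct injections in an extensive category.

module _ {C : Category o ℓ e} (coprod : HasFiniteCoproducts C)
         (extensive : Extensive coprod) where
  open Category C
  private
    module ∐ {n} (X : Fin n → Obj) = Coproduct (coprod X)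

    _+_ : Obj → Obj → Obj
    _+_ = _⊕_ coprod

    infixr 6 _+₁_
    _+₁_ : ∀ {A A′ B B′} → A ⇒ A′ → B ⇒ B′ → A + B ⇒ A′ + B′
    _+₁_ = _⊕₁_ coprod

    inl : ∀ {A B} → A ⇒ A + B
    inl {A} {B} = ∐.inj (A ∷ B ∷ []) zero

    inr : ∀ {A B} → B ⇒ A + B
    inr {A} {B} = ∐.inj (A ∷ B ∷ []) (suc zero)

    𝟘 : Obj
    𝟘 = ∐.obj []

    ¡ : ∀ {A} → 𝟘 ⇒ A
    ¡ = ∐.[ [] ] λ ()

    ¡-unique : ∀ {A} (f g : 𝟘 ⇒ A) → f ≈ g
    ¡-unique f g = ∐-jointly-epic coprod [] f g λ ()

    +₁-inl : ∀ {A A′ B B′} (f : A ⇒ A′) (g : B ⇒ B′) →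
             (f +₁ g) ∘ inl ≈ inl ∘ f
    +₁-inl {A} {A′} {B} {B′} f g =
      ∐₁-inj coprod {X = A ∷ B ∷ []} {A′ ∷ B′ ∷ []} (pair coprod f g) zero

    -- The copairing of `id` and `¡` is a retraction. With a general summand `B` in place of `𝟘`
    -- there need be no morphism `B ⇒ A` to copair with.
    inl-𝟘-monic : ∀ {A} → IsMono C (inl {A} {𝟘})
    inl-𝟘-monic {A} = ∘-monicˡ C (∐.commute (A ∷ 𝟘 ∷ []) copair zero)
      λ f g p → Equiv.trans (Equiv.sym identityˡ) (Equiv.trans p identityˡ)
      where
      copair : ∀ i → (A ∷ 𝟘 ∷ []) i ⇒ A
      copair zero       = id
      copair (suc zero) = ¡

  -- If inl ∘ f ≈ inl ∘ g then the identity of Z + 0 is a morphism from f + ¡ to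
  -- g + ¡ over A + B.  Fullness of the canonical functor yields u over A from f
  -- to g with u + v ≈ id; since inl : Z → Z + 0 is split, u ≈ id.
  inl-monic : ∀ {A B} → IsMono C (inl {A} {B})
  inl-monic {A} {B} {Z} f g inl∘f≈inl∘g = begin
    f                   ≈⟨ SliceHom.triangle u ⟨
    g ∘ SliceHom.mor u  ≈⟨ ∘-resp-≈ Equiv.refl u≈id ⟩
    g ∘ id              ≈⟨ identityʳ ⟩
    g                   ∎
    where
    open HomReasoning

    g+¡≈f+¡ : g +₁ ¡ {B} ≈ f +₁ ¡ {B}
    g+¡≈f+¡ = ∐-jointly-epic coprod (Z ∷ 𝟘 ∷ []) _ _ λ where
      zero → begin
        (g +₁ ¡) ∘ inl  ≈⟨ +₁-inl g ¡ ⟩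
        inl ∘ g         ≈⟨ inl∘f≈inl∘g ⟨
        inl ∘ f         ≈⟨ +₁-inl f ¡ ⟨
        (f +₁ ¡) ∘ inl  ∎
      (suc zero) → ¡-unique _ _

    preimage = equivalence-full (extensive A B)
      {sliceObj f , sliceObj (¡ {B})} {sliceObj g , sliceObj (¡ {B})}
      (sliceHom id (Equiv.trans identityʳ g+¡≈f+¡))

    u = proj₁ (proj₁ preimage)
    v = proj₂ (proj₁ preimage)

    u≈id : SliceHom.mor u ≈ id
    u≈id = inl-𝟘-monic _ _ (begin
      inl ∘ SliceHom.mor u                    ≈⟨ +₁-inl _ _ ⟨
      (SliceHom.mor u +₁ SliceHom.mor v) ∘ inl  ≈⟨ ∘-resp-≈ (proj₂ preimage) Equiv.refl ⟩
      id ∘ inl                                ≈⟨ identityˡ ⟩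
      inl                                     ≈⟨ identityʳ ⟨
      inl ∘ id                                ∎)

  -- The morphism ∐ X → X i + ∐ X that sends the i-th summand to the left and
  -- all others to the right extends inl along inj i.
  inj-monic : ∀ {n} (X : Fin n → Obj) i → IsMono C (∐.inj X i)
  inj-monic X i = ∘-monicˡ C
    (Equiv.trans (∐.commute X (λ j → separate j (i ≟ j)) i)
                 separate-diagonal)
    inl-monic
    where
    -- The right summand is all of `∐ X`, not a complement of `X i`, since `inj` already sends every
    -- other summand there. The decision is an argument so that `i ≟ i` can be rewritten to
    -- `yes refl` on the diagonal.
    separate : ∀ j → Dec (i ≡ j) → X j ⇒ X i + ∐.obj X
    separate j (yes refl) = inl
    separate j (no _)     = inr ∘ ∐.inj X j

    separate-diagonal : separate i (i ≟ i) ≈ inl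
    separate-diagonal rewrite ≡-≟-identity _≟_ {i} refl = Equiv.refl

-- Coalgebra isomorphisms and transfer of simplicity.

module _ {C : Category o ℓ e} (F : Functor C C) where
  open Category C
  open Functor F

  carriesMorphism-resp-≈ : ∀ {X Y} {ξ ξ′ : X ⇒ F₀ X} {q : X ⇒ Y} → ξ ≈ ξ′ →
                           CarriesMorphism F ξ q → CarriesMorphism F ξ′ q
  carriesMorphism-resp-≈ ξ≈ξ′ (ζ , m) =
    ζ , Equiv.trans m (∘-resp-≈ Equiv.refl ξ≈ξ′)

  -- Inserting `F₁ (inv ∘ h)` on the left of `α ∘ inv` lets the square of `h` turn `α` into `β`,
  -- after which `h ∘ inv` cancels. Simplicity can thus be tested in the base category, which
  -- coalgebras for different functors share.
  iso-reflects : ∀ {A B : Coalgebra F} (h : CoalgebraHom F A B) →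
                 IsIso C (CoalgebraHom.hom h) → IsIso (Coalg F) h
  iso-reflects {coalgebra α} {coalgebra β} (coalgebraHom h βh≈Fhα) h-iso = record
    { inv  = coalgebraHom inv (begin
        α ∘ inv                        ≈⟨ identityˡ ⟨
        id ∘ (α ∘ inv)                 ≈⟨ ∘-resp-≈ identity Equiv.refl ⟨
        F₁ id ∘ (α ∘ inv)              ≈⟨ ∘-resp-≈ (F-resp-≈ isoˡ) Equiv.refl ⟨
        F₁ (inv ∘ h) ∘ (α ∘ inv)       ≈⟨ ∘-resp-≈ homomorphism Equiv.refl ⟩
        (F₁ inv ∘ F₁ h) ∘ (α ∘ inv)    ≈⟨ assoc ⟩
        F₁ inv ∘ (F₁ h ∘ (α ∘ inv))    ≈⟨ ∘-resp-≈ Equiv.refl assoc ⟨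
        F₁ inv ∘ ((F₁ h ∘ α) ∘ inv)    ≈⟨ ∘-resp-≈ Equiv.refl (∘-resp-≈ βh≈Fhα Equiv.refl) ⟨
        F₁ inv ∘ ((β ∘ h) ∘ inv)       ≈⟨ ∘-resp-≈ Equiv.refl assoc ⟩
        F₁ inv ∘ (β ∘ (h ∘ inv))       ≈⟨ ∘-resp-≈ Equiv.refl (∘-resp-≈ Equiv.refl isoʳ) ⟩
        F₁ inv ∘ (β ∘ id)              ≈⟨ ∘-resp-≈ Equiv.refl identityʳ ⟩
        F₁ inv ∘ β                     ∎)
    ; isoˡ = isoˡ
    ; isoʳ = isoʳ
    }
    where
    open IsIso h-iso
    open HomReasoning

  iso-forget : ∀ {A B : Coalgebra F} {h : CoalgebraHom F A B} →
               IsIso (Coalg F) h → IsIso C (CoalgebraHom.hom h)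
  iso-forget h-iso = record
    { inv  = CoalgebraHom.hom (IsIso.inv h-iso)
    ; isoˡ = IsIso.isoˡ h-iso
    ; isoʳ = IsIso.isoʳ h-iso
    }

-- Simplicity of (X , ξ) refers only to the regular epimorphisms that carry
-- morphisms out of it, so it transfers even between different functors.
simple-transfer : {C : Category o ℓ e} (F G : Functor C C) →
  let open Category C in
  ∀ {X} {ξ : X ⇒ Functor.F₀ F X} {ξ′ : X ⇒ Functor.F₀ G X} →
  (∀ {Y} (q : X ⇒ Y) → IsRegularEpi C q →
     CarriesMorphism G ξ′ q → CarriesMorphism F ξ q) →
  IsSimple F (coalgebra ξ) → IsSimple G (coalgebra ξ′)
simple-transfer F G G⇒F simple h h-regular =
  iso-reflects G h (iso-forget F (simple (coalgebraHom (hom h) (proj₂ carried)) h-regular))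
  where
  open CoalgebraHom
  carried = G⇒F (hom h) h-regular (_ , isMorphism h)

-- Coalgebras along a natural transformation with monic components.

module _ {C : Category o ℓ e} {F G : Functor C C} (τ : NaturalTransformation F G)
         (τ-monic : ∀ A → IsMono C (NaturalTransformation.component τ A)) where
  open Category C
  private
    module F = Functor F
    module G = Functor G
  open NaturalTransformation τ renaming (component to τ′)

  transform-morphism : ∀ {X Y} {ξ : X ⇒ F.F₀ X} {ζ : Y ⇒ F.F₀ Y} {q : X ⇒ Y} →
    IsCoalgebraMorphism F ξ ζ q →
    IsCoalgebraMorphism G (τ′ X ∘ ξ) (τ′ Y ∘ ζ) q
  transform-morphism {X} {Y} {ξ} {ζ} {q} m = begin
    (τ′ Y ∘ ζ) ∘ q         ≈⟨ assoc ⟩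
    τ′ Y ∘ (ζ ∘ q)         ≈⟨ ∘-resp-≈ Equiv.refl m ⟩
    τ′ Y ∘ (F.F₁ q ∘ ξ)    ≈⟨ assoc ⟨
    (τ′ Y ∘ F.F₁ q) ∘ ξ    ≈⟨ ∘-resp-≈ (natural q) Equiv.refl ⟩
    (G.F₁ q ∘ τ′ X) ∘ ξ    ≈⟨ assoc ⟩
    G.F₁ q ∘ (τ′ X ∘ ξ)    ∎
    where open HomReasoning

  transform-carries : ∀ {X Y} {ξ : X ⇒ F.F₀ X} {q : X ⇒ Y} →
    CarriesMorphism F ξ q → CarriesMorphism G (τ′ X ∘ ξ) q
  transform-carries (ζ , m) = τ′ _ ∘ ζ , transform-morphism m

  reflect-carries : ∀ {X Y} {ξ : X ⇒ F.F₀ X} {q : X ⇒ Y} → IsRegularEpi C q →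
    CarriesMorphism G (τ′ X ∘ ξ) q → CarriesMorphism F ξ q
  reflect-carries {X} {Y} {ξ} {q} (_ , f , g , coeq) (ζ , m) =
    -- The factorization equation through `q` is literally the coalgebra morphism equation.
    factor (F.F₁ q ∘ ξ) respects , factors (F.F₁ q ∘ ξ) respects
    where
    open IsCoequalizer coeq
    open HomReasoning

    τFqξ≈ζq : τ′ Y ∘ (F.F₁ q ∘ ξ) ≈ ζ ∘ q
    τFqξ≈ζq = begin
      τ′ Y ∘ (F.F₁ q ∘ ξ)  ≈⟨ assoc ⟨
      (τ′ Y ∘ F.F₁ q) ∘ ξ  ≈⟨ ∘-resp-≈ (natural q) Equiv.refl ⟩
      (G.F₁ q ∘ τ′ X) ∘ ξ  ≈⟨ assoc ⟩
      G.F₁ q ∘ (τ′ X ∘ ξ)  ≈⟨ m ⟨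
      ζ ∘ q                ∎

    respects : (F.F₁ q ∘ ξ) ∘ f ≈ (F.F₁ q ∘ ξ) ∘ g
    respects = τ-monic Y _ _ (begin
      τ′ Y ∘ ((F.F₁ q ∘ ξ) ∘ f)  ≈⟨ assoc ⟨
      (τ′ Y ∘ (F.F₁ q ∘ ξ)) ∘ f  ≈⟨ ∘-resp-≈ τFqξ≈ζq Equiv.refl ⟩
      (ζ ∘ q) ∘ f                ≈⟨ assoc ⟩
      ζ ∘ (q ∘ f)                ≈⟨ ∘-resp-≈ Equiv.refl coequalizes ⟩
      ζ ∘ (q ∘ g)                ≈⟨ assoc ⟨
      (ζ ∘ q) ∘ g                ≈⟨ ∘-resp-≈ τFqξ≈ζq Equiv.refl ⟨
      (τ′ Y ∘ (F.F₁ q ∘ ξ)) ∘ g  ≈⟨ assoc ⟩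
      τ′ Y ∘ ((F.F₁ q ∘ ξ) ∘ g)  ∎)

  same-quotients : ∀ {X Y} (ξ : X ⇒ F.F₀ X) (q : X ⇒ Y) → IsRegularEpi C q →
    CarriesMorphism F ξ q ⇔ CarriesMorphism G (τ′ X ∘ ξ) q
  same-quotients ξ q q-regular = mk⇔ transform-carries (reflect-carries q-regular)

  -- Only simplicity of the codomain has to be moved; it transfers because the correspondence of
  -- quotients also holds for coalgebras on `Y`.
  same-simple-quotient : ∀ {X Y} (ξ : X ⇒ F.F₀ X) (q : X ⇒ Y) →
    CarriesSimpleQuotient F ξ q ⇔ CarriesSimpleQuotient G (τ′ X ∘ ξ) q
  same-simple-quotient {X} {Y} ξ q = mk⇔ transform reflect
    where
    transform : CarriesSimpleQuotient F ξ q → CarriesSimpleQuotient G (τ′ X ∘ ξ) q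
    transform (ζ , m , q-regular , simple) =
      τ′ Y ∘ ζ , transform-morphism m , q-regular ,
      simple-transfer F G (λ h h-regular → reflect-carries h-regular) simple

    reflect : CarriesSimpleQuotient G (τ′ X ∘ ξ) q → CarriesSimpleQuotient F ξ q
    reflect (ζ′ , m′ , q-regular@(_ , _ , _ , coeq) , simple) =
      ζ , m , q-regular ,
      simple-transfer G F
        (λ h _ carries → carriesMorphism-resp-≈ G τζ≈ζ′ (transform-carries carries))
        simple
      where
      carried = reflect-carries q-regular (ζ′ , m′)
      ζ = proj₁ carried
      m = proj₂ carried

      -- Simplicity is given for `ζ′`, whereas the transfer speaks of `τ′ Y ∘ ζ`. Both make `q` a
      -- `G`-coalgebra morphism, and `q` is epic.
      τζ≈ζ′ : τ′ Y ∘ ζ ≈ ζ′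
      τζ≈ζ′ = coequalizer⇒epic C coeq _ _
        (Equiv.trans (transform-morphism m) (Equiv.sym m′))

corollary8p16 : ∀ {o ℓ e : Level} (C : Category o ℓ e) →
    FinitelyComplete C →
    HasCoequalizers C →
    (coprod : HasFiniteCoproducts C) →
    RegularEpisClosedUnderComposition C →
    (n : ℕ) →
    (H : Functor (Power C n) (Power C n)) →
    PreservesMonos H →
    Extensive coprod →
    let open Category (Power C n) in
    (X : Obj) (ξ : X ⇒ Functor.F₀ H X) →
    (∀ (Y : Obj) (q : X ⇒ Y) → IsRegularEpi (Power C n) {X} {Y} q →
    CarriesMorphism H {X} {Y} ξ q
    ⇔ CarriesMorphism (HΔ∐ coprod H) {X} {Y} (induced coprod H X ξ) q)
    ×
    (∀ (Y : Obj) (q : X ⇒ Y) →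
    CarriesSimpleQuotient H {X} {Y} ξ q
    ⇔ CarriesSimpleQuotient (HΔ∐ coprod H) {X} {Y} (induced coprod H X ξ) q)
corollary8p16 C _ _ coprod _ n H H-monos extensive X ξ =
  -- The induced structure unfolds to the component of `Hη` at `X` composed with `ξ`.
  (λ Y q → same-quotients Hη Hη-monic {X} {Y} ξ q) ,
  (λ Y q → same-simple-quotient Hη Hη-monic {X} {Y} ξ q)
  where
  Hη : NaturalTransformation H (HΔ∐ coprod H)
  Hη = record
    { component = λ A → H.F₁ (η.component A)
    ; natural   = λ f → Equiv.trans (Equiv.sym H.homomorphism)
        (Equiv.trans (H.F-resp-≈ (η.natural f)) H.homomorphism)
    }
    where
    open Category (Power C n)
    module H = Functor H
    module η = NaturalTransformation (η coprod n)

  Hη-monic : ∀ A → IsMono (Power C n) (NaturalTransformation.component Hη A)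
  -- Composition and equality in the power are componentwise, so a family of monic injections is
  -- monic there.
  Hη-monic A = H-monos _ λ f g p i → inj-monic coprod extensive A i (f i) (g i) (p i)
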